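{- Let $r,n\ge 1$ be integers, let $s\in\{1,\dots,r\}$ and let $k\in\{0,1,\dots,n\}$. Let $\mathcal{B}$ be the family of all words $w\in[s]^n$ in which the symbol $s$ appears at most $k$ times. Then for every family $\mathcal{F}\subseteq[r]^n$ with $|\mathcal{F}|=|\mathcal{B}|$ we have $|\Delta\mathcal{F}|\ge|\Delta\mathcal{B}|$. That is, $\mathcal{B}$ has minimal deletion shadow among all families in $[r]^n$ of the same size.
   Context: Words of length $n$ over the alphabet $[r]=\{1,\dots,r\}$ are elements of $[r]^n$. For a family $\mathcal{F}\subseteq[r]^n$ and $i\in[n]$, the deletion shadow in direction $i$ is $\delta_i\mathcal{F}=\{(x_1,\dots,x_{i-1},x_{i+1},\dots,x_n):(x_1,\dots,x_n)\in\mathcal{F}\}\subseteq[r]^{n-1}$, and the deletion shadow is $\Delta\mathcal{F}=\bigcup_{i=1}^n\delta_i\mathcal{F}$, i.e. the set of all words obtainable by deleting one letter from a word of $\mathcal{F}$. -}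

module Defs where

open import Data.Fin.Base using (Fin; _≤_)
import Data.Fin.Properties as Fin
open import Data.List.Base using (List; []; _∷_; length; filter; allFin; cartesianProductWith)
open import Data.List.Membership.Propositional using (_∈_; find; lose)
open import Data.List.Membership.Propositional.Properties using (∈-allFin; ∈-cartesianProductWith⁺)
open import Data.List.Relation.Unary.All as ListAll using ()
import Data.List.Relation.Unary.AllPairs as AllPairs
open import Data.List.Relation.Unary.Any using (here; any?)
open import Data.List.Relation.Unary.Unique.Propositional using (Unique)
open import Data.List.Relation.Unary.Unique.Propositional.Properties
  using (allFin⁺; cartesianProductWith⁺)
open import Data.Nat.Base as ℕ using (ℕ; zero; suc)
import Data.Nat.Properties as ℕ
open import Data.Product.Base using (∃; ∃-syntax; _×_; _,_)
open import Data.Vec.Base using (Vec; []; _∷_; count; removeAt)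
open import Data.Vec.Properties using (≡-dec; ∷-injective)
open import Data.Vec.Relation.Unary.All using (All; all?)
open import Level using (0ℓ)
open import Relation.Binary.PropositionalEquality using (_≡_; refl)
open import Relation.Nullary.Decidable using (Dec; map′; _×-dec_)
open import Relation.Unary using (Pred; Decidable; ⋃)

Word : ℕ → ℕ → Set
Word r n = Vec (Fin r) n

Family : ℕ → ℕ → Set₁
Family r n = Pred (Word r n) 0ℓ

words : ∀ r n → List (Word r n)
words r zero    = [] ∷ []
words r (suc n) = cartesianProductWith _∷_ (allFin r) (words r n)

words-complete : ∀ {r n} (w : Word r n) → w ∈ words r n
words-complete []      = here refl
words-complete (a ∷ w) = ∈-cartesianProductWith⁺ _∷_ (∈-allFin a) (words-complete w)

words-unique : ∀ r n → Unique (words r n)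
words-unique r zero    = ListAll.[] AllPairs.∷ AllPairs.[]
words-unique r (suc n) = cartesianProductWith⁺ _∷_ ∷-injective (allFin⁺ r) (words-unique r n)

∣_∣ : ∀ {r n} {F : Family r n} → Decidable F → ℕ
∣_∣ {r} {n} F? = length (filter F? (words r n))

∃? : ∀ {r n} {F : Family r n} → Decidable F → Dec (∃ F)
∃? {r} {n} F? = map′ (λ p → let w , _ , Fw = find p in w , Fw)
                     (λ (w , Fw) → lose (words-complete w) Fw)
                     (any? F? (words r n))

δ : ∀ {r n} → Fin (suc n) → Family r (suc n) → Family r n
δ i F y = ∃[ x ] F x × removeAt x i ≡ y

Δ : ∀ {r n} → Family r (suc n) → Family r n
Δ {n = n} F = ⋃ (Fin (suc n)) (λ i → δ i F)

δ? : ∀ {r n} (i : Fin (suc n)) {F : Family r (suc n)} → Decidable F → Decidable (δ i F)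
δ? i F? y = ∃? (λ x → F? x ×-dec ≡-dec Fin._≟_ (removeAt x i) y)

Δ? : ∀ {r n} {F : Family r (suc n)} → Decidable F → Decidable (Δ F)
Δ? F? y = Fin.any? (λ i → δ? i F? y)

-- The symbols 1, …, r are the elements of Fin r in increasing order, so
-- for s : Fin r the alphabet [s] ⊆ [r] is { a ∣ a ≤ s }, s itself included.
ℬ : ∀ {r n} → Fin r → ℕ → Family r n
ℬ s k w = All (_≤ s) w × count (Fin._≟ s) w ℕ.≤ k

ℬ? : ∀ {r n} (s : Fin r) (k : ℕ) → Decidable (ℬ {r} {n} s k)
ℬ? s k w = all? (Fin._≤? s) w ×-dec (count (Fin._≟ s) w ℕ.≤? k)

{-# OPTIONS --safe #-}
module Submission where

-- Put q = s − 1 and let b n j be the number of words of length n over [s]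
-- with at most j symbols s, so b (n+1) j = q b n j + b n (j−1).  One shows
--
--   ∑ (j < n) min(|F|, b n j) ≤ n q |ΔF|   for every F ⊆ [r]ⁿ;
--
-- the left side is concave in |F|, and for |F| = b n k it is n q b (n−1) k.
-- With F_a = { w ∣ a w ∈ F } one has |ΔF| ≥ |F_a| and |ΔF| ≥ ∑ |ΔF_a|, so by
-- induction it suffices to bound a sum of concave functions of the |F_a| under
-- the constraints |F_a| ≤ |ΔF| and ∑ |F_a| = |F|.  Its minimum is at the
-- extreme point where q of the sizes are maximal and one takes the remainder.

open import Defs
open import Algebra.Properties.Semiring.Sum
  using (sum; sum-cong-≗; sum-init-last; ∑-distrib-+; ∑-comm; *-distribˡ-sum)
open import Data.Bool.Base using (true; false)
open import Data.Fin.Base as Fin using (Fin; zero; suc; toℕ)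
import Data.Fin.Properties as Fin
open import Data.List.Base as List using (List; []; _∷_; _++_; length; filter; cartesianProductWith)
open import Data.List.Properties using (length-++; filter-++; filter-none; filter-some)
open import Data.List.Membership.Propositional using (lose)
import Data.List.Relation.Unary.All as ListAll
open import Data.List.Relation.Binary.Sublist.Propositional using (⊆-refl)
open import Data.List.Relation.Binary.Sublist.Propositional.Properties using (filter⁺)
open import Data.List.Relation.Binary.Sublist.Heterogeneous.Properties using (length-mono-≤)
open import Data.Nat.Base
  using (ℕ; zero; suc; 2+; _+_; _*_; _∸_; _⊓_; _≤_; z≤n; s≤s; NonZero; ≢-nonZero)
open import Data.Nat.Properties
open import Data.Nat.Tactic.RingSolver using (solve-∀)
open import Data.Product.Base using (_,_)
open import Data.Sum.Base using (inj₁; inj₂)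
open import Data.Vec.Base using ([]; _∷_; count; removeAt)
open import Data.Vec.Relation.Unary.All using (All; []; _∷_)
open import Function.Base using (_∘_)
open import Relation.Binary.PropositionalEquality
  using (_≡_; _≢_; refl; sym; trans; cong; cong₂; subst; module ≡-Reasoning)
open import Relation.Nullary using (¬_; does; yes; no; contradiction)
open import Relation.Nullary.Decidable using (dec-true; dec-false)
open import Relation.Unary using (Pred; Decidable; _⊆_)

-- Finite sums, and a lower bound for sums of truncated numbers.

∑ : ∀ n → (Fin n → ℕ) → ℕ
∑ n = sum +-*-semiring {n}

∑-mono : ∀ n {f g : Fin n → ℕ} → (∀ i → f i ≤ g i) → ∑ n f ≤ ∑ n g
∑-mono zero    f≤g = z≤n
∑-mono (suc n) f≤g = +-mono-≤ (f≤g zero) (∑-mono n (f≤g ∘ suc))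

∑-cong : ∀ n {f g : Fin n → ℕ} → (∀ i → f i ≡ g i) → ∑ n f ≡ ∑ n g
∑-cong n = sum-cong-≗ +-*-semiring {n}

∑-const : ∀ n c → ∑ n (λ _ → c) ≡ n * c
∑-const zero    c = refl
∑-const (suc n) c = cong (c +_) (∑-const n c)

∑-+ : ∀ n (f g : Fin n → ℕ) → ∑ n (λ i → f i + g i) ≡ ∑ n f + ∑ n g
∑-+ n = ∑-distrib-+ +-*-semiring {n}

∑-* : ∀ n c (f : Fin n → ℕ) → c * ∑ n f ≡ ∑ n (λ i → c * f i)
∑-* n = *-distribˡ-sum +-*-semiring {n}

∑-last : ∀ n (f : ℕ → ℕ) → ∑ (suc n) (f ∘ toℕ) ≡ ∑ n (f ∘ toℕ) + f n
∑-last n f = trans (sum-init-last +-*-semiring {n} (f ∘ toℕ))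
  (cong₂ _+_ (∑-cong n λ i → cong f (Fin.toℕ-inject₁ i)) (cong f (Fin.toℕ-fromℕ n)))

-- The recursion of `ball` mixes the indices j and j - 1. Splitting off the last term of `f` and the
-- vanishing first term of `h` lets both sums run over the same n indices.
∑-shift : ∀ n (f h : ℕ → ℕ) → h 0 ≡ 0 →
          ∑ (suc n) (λ i → f (toℕ i) + h (toℕ i)) ≡
          (∑ n (f ∘ toℕ) + f n) + ∑ n (h ∘ suc ∘ toℕ)
∑-shift n f h h0 = trans (∑-+ (suc n) (f ∘ toℕ) (h ∘ toℕ))
  (cong₂ _+_ (∑-last n f) (cong (_+ ∑ n (h ∘ suc ∘ toℕ)) h0))

-- ⊓ B is concave and vanishes at 0, so under the constraints x a ≤ T and
-- ∑ x = q T + R the sum is least when q of the x a are T and one is R.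
∑-⊓-lower : ∀ {r} (x : Fin r → ℕ) T B q R → (∀ a → x a ≤ T) →
            q * T + R ≤ ∑ r x → q * (T ⊓ B) + R ⊓ B ≤ ∑ r (λ a → x a ⊓ B)
∑-⊓-lower {zero} x T B q R x≤T h =
  ≤-trans (+-mono-≤ (*-monoʳ-≤ q (m⊓n≤m T B)) (m⊓n≤m R B)) h
∑-⊓-lower {suc r} x T B q R x≤T h with ≤-total R (x zero)
∑-⊓-lower {suc r} x T B zero R x≤T h | inj₁ R≤x₀ =
  ≤-trans (⊓-monoˡ-≤ B R≤x₀) (m≤m+n _ _)
∑-⊓-lower {suc r} x T B (suc q) R x≤T h | inj₁ R≤x₀ = begin
  T ⊓ B + q * (T ⊓ B) + R ⊓ B                  ≡⟨ arith₁ (T ⊓ B) (q * (T ⊓ B)) (R ⊓ B) ⟩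
  T ⊓ B + R ⊓ B + q * (T ⊓ B)                  ≤⟨ +-monoˡ-≤ (q * (T ⊓ B)) exchange ⟩
  x₀ ⊓ B + R′ ⊓ B + q * (T ⊓ B)                ≡⟨ arith₂ (x₀ ⊓ B) (R′ ⊓ B) (q * (T ⊓ B)) ⟩
  x₀ ⊓ B + (q * (T ⊓ B) + R′ ⊓ B)              ≤⟨ +-monoʳ-≤ (x₀ ⊓ B) ih ⟩
  x₀ ⊓ B + ∑ r (λ a → x (suc a) ⊓ B)             ∎
  where
  open ≤-Reasoning
  x₀ = x zero
  -- One copy of `T` is exchanged for `x₀` and its shortfall goes to the remainder. The pairs `T`,
  -- `R` and `x₀`, `R′` have equal sums, and the second lies between `R` and `T`, so concavity
  -- favours it.
  R′ = R + (T ∸ x₀)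
  arith₁ : ∀ a b c → a + b + c ≡ a + c + b
  arith₁ = solve-∀
  arith₂ : ∀ a b c → a + b + c ≡ a + (c + b)
  arith₂ = solve-∀
  arith₃ : ∀ x d q r → x + (q + (r + d)) ≡ (d + x) + q + r
  arith₃ = solve-∀
  arith₄ : ∀ x d r → x + (r + d) ≡ d + x + r
  arith₄ = solve-∀
  x₀+R′ : x₀ + R′ ≡ T + R
  x₀+R′ = trans (arith₄ x₀ (T ∸ x₀) R) (cong (_+ R) (m∸n+n≡m (x≤T zero)))
  R≤R′ : R ≤ R′
  R≤R′ = m≤m+n R _
  exchange : T ⊓ B + R ⊓ B ≤ x₀ ⊓ B + R′ ⊓ B
  exchange with ≤-total x₀ B | ≤-total R′ B
  ... | inj₁ x₀≤B | inj₁ R′≤B rewrite m≤n⇒m⊓n≡m x₀≤B | m≤n⇒m⊓n≡m R′≤B | x₀+R′ =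
    +-mono-≤ (m⊓n≤m T B) (m⊓n≤m R B)
  ... | inj₁ x₀≤B | inj₂ B≤R′ rewrite m≤n⇒m⊓n≡m x₀≤B | m≥n⇒m⊓n≡n B≤R′ | +-comm x₀ B =
    +-mono-≤ (m⊓n≤n T B) (≤-trans (m⊓n≤m R B) R≤x₀)
  ... | inj₂ B≤x₀ | _ rewrite m≥n⇒m⊓n≡n B≤x₀ =
    +-mono-≤ (m⊓n≤n T B) (⊓-monoˡ-≤ B R≤R′)
  ih : q * (T ⊓ B) + R′ ⊓ B ≤ ∑ r (λ a → x (suc a) ⊓ B)
  ih = ∑-⊓-lower (x ∘ suc) T B q R′ (x≤T ∘ suc) (+-cancelˡ-≤ x₀ _ _ (begin
    x₀ + (q * T + R′)        ≡⟨ arith₃ x₀ (T ∸ x₀) (q * T) R ⟩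
    T ∸ x₀ + x₀ + q * T + R  ≡⟨ cong (λ z → z + q * T + R) (m∸n+n≡m (x≤T zero)) ⟩
    suc q * T + R            ≤⟨ h ⟩
    ∑ (suc r) x                      ∎))
∑-⊓-lower {suc r} x T B q R x≤T h | inj₂ x₀≤R = begin
  q * (T ⊓ B) + R ⊓ B                     ≡⟨ cong (λ z → q * (T ⊓ B) + z ⊓ B) (m+[n∸m]≡n x₀≤R) ⟨
  q * (T ⊓ B) + (x₀ + R′) ⊓ B             ≤⟨ +-monoʳ-≤ (q * (T ⊓ B)) subadditive ⟩
  q * (T ⊓ B) + (x₀ ⊓ B + R′ ⊓ B)         ≡⟨ arith (q * (T ⊓ B)) (x₀ ⊓ B) (R′ ⊓ B) ⟩
  x₀ ⊓ B + (q * (T ⊓ B) + R′ ⊓ B)         ≤⟨ +-monoʳ-≤ (x₀ ⊓ B) ih ⟩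
  x₀ ⊓ B + ∑ r (λ a → x (suc a) ⊓ B)        ∎
  where
  open ≤-Reasoning
  x₀ = x zero
  -- No copy of `T` is spent here: `x₀` is taken out of the remainder, and truncation at `B` is
  -- subadditive.
  R′ = R ∸ x₀
  arith : ∀ a b c → a + (b + c) ≡ b + (a + c)
  arith = solve-∀
  subadditive : (x₀ + R′) ⊓ B ≤ x₀ ⊓ B + R′ ⊓ B
  subadditive with ≤-total x₀ B | ≤-total R′ B
  ... | inj₁ x₀≤B | inj₁ R′≤B rewrite m≤n⇒m⊓n≡m x₀≤B | m≤n⇒m⊓n≡m R′≤B = m⊓n≤m _ B
  ... | inj₁ x₀≤B | inj₂ B≤R′ rewrite m≥n⇒m⊓n≡n B≤R′ = ≤-trans (m⊓n≤n _ B) (m≤n+m B _)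
  ... | inj₂ B≤x₀ | _ rewrite m≥n⇒m⊓n≡n B≤x₀ = ≤-trans (m⊓n≤n _ B) (m≤m+n B _)
  ih : q * (T ⊓ B) + R′ ⊓ B ≤ ∑ r (λ a → x (suc a) ⊓ B)
  ih = ∑-⊓-lower (x ∘ suc) T B q R′ (x≤T ∘ suc) (+-cancelˡ-≤ x₀ _ _ (begin
    x₀ + (q * T + R′)        ≡⟨ arith x₀ (q * T) R′ ⟩
    q * T + (x₀ + R′)        ≡⟨ cong (q * T +_) (m+[n∸m]≡n x₀≤R) ⟩
    q * T + R                ≤⟨ h ⟩
    ∑ (suc r) x                      ∎))

-- Sizes of the families `ℬ`, given by their recursion.

previous : (ℕ → ℕ) → ℕ → ℕ
-- The value at index -1: no word has fewer than zero symbols s.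
previous f zero    = 0
previous f (suc j) = f j

-- The b n j above, with q = toℕ s.
ball : ℕ → ℕ → ℕ → ℕ
ball q zero    j = 1
ball q (suc n) j = q * ball q n j + previous (ball q n) j

previous-mono : ∀ {f} → (∀ {i j} → i ≤ j → f i ≤ f j) →
                ∀ {i j} → i ≤ j → previous f i ≤ previous f j
previous-mono f-mono z≤n       = z≤n
previous-mono f-mono (s≤s i≤j) = f-mono i≤j

ball-mono : ∀ q n {i j} → i ≤ j → ball q n i ≤ ball q n j
ball-mono q zero    i≤j = ≤-refl
ball-mono q (suc n) i≤j =
  +-mono-≤ (*-monoʳ-≤ q (ball-mono q n i≤j)) (previous-mono (ball-mono q n) i≤j)

-- A word of length n contains s at most n times, so the sizes are saturated from j = n on.
ball≤ball-n : ∀ q n j → ball q n j ≤ ball q n n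
ball≤ball-n q zero    j       = ≤-refl
ball≤ball-n q (suc n) zero    = ball-mono q (suc n) z≤n
ball≤ball-n q (suc n) (suc j) =
  +-mono-≤ (*-monoʳ-≤ q (≤-trans (ball≤ball-n q n (suc j)) (ball-mono q n (n≤1+n n))))
           (ball≤ball-n q n j)

-- Truncated sums of ball sizes, and the induction step.

module _ (q : ℕ) where

  -- The concave left side of the main inequality, as a function of m = |F|.
  cap : ℕ → ℕ → ℕ
  cap n m = ∑ n (λ i → m ⊓ ball q n (toℕ i))

  -- The part cut off by the truncations in `cap`. Multiplied by `q`, it becomes the remainder `R`
  -- in `merge`.
  excess : ℕ → ℕ → ℕ
  excess n m = ∑ n (λ i → m ∸ ball q n (toℕ i))

  cap-mono : ∀ n {l m} → l ≤ m → cap n l ≤ cap n m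
  cap-mono n l≤m = ∑-mono n λ i → ⊓-monoˡ-≤ (ball q n (toℕ i)) l≤m

  excess-mono : ∀ n {l m} → l ≤ m → excess n l ≤ excess n m
  excess-mono n l≤m = ∑-mono n λ i → ∸-monoˡ-≤ (ball q n (toℕ i)) l≤m

  cap+excess : ∀ n m → cap n m + excess n m ≡ n * m
  cap+excess n m = begin
    cap n m + excess n m
      ≡⟨ ∑-+ n _ _ ⟨
    ∑ n (λ i → m ⊓ b i + (m ∸ b i))
      ≡⟨ ∑-cong n (λ i → trans (cong (_+ (m ∸ b i)) (⊓-comm m (b i))) (m⊓n+n∸m≡n (b i) m)) ⟩
    ∑ n (λ _ → m)
      ≡⟨ ∑-const n m ⟩
    n * m
      ∎
    where
    open ≡-Reasoning
    b : Fin n → ℕ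
    b i = ball q n (toℕ i)

  cap-zero : ∀ n → cap n 0 ≡ 0
  cap-zero n = trans (∑-const n 0) (*-zeroʳ n)

  -- Monotonicity of the ball sizes makes min commute with the recursion.
  ball-⊓ : ∀ n j i → ball q (suc n) j ⊓ ball q (suc n) i ≡
           q * (ball q n j ⊓ ball q n i) + previous (ball q n) j ⊓ previous (ball q n) i
  ball-⊓ n j i with ≤-total i j
  ... | inj₁ i≤j rewrite m≥n⇒m⊓n≡n (ball-mono q n i≤j)
                       | m≥n⇒m⊓n≡n (previous-mono (ball-mono q n) i≤j) =
    m≥n⇒m⊓n≡n (ball-mono q (suc n) i≤j)
  ... | inj₂ j≤i rewrite m≤n⇒m⊓n≡m (ball-mono q n j≤i)
                       | m≤n⇒m⊓n≡m (previous-mono (ball-mono q n) j≤i) =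
    m≤n⇒m⊓n≡m (ball-mono q (suc n) j≤i)

  -- After `ball-⊓` splits every term, the first part has one extra index, j = n, where the
  -- truncation is void by saturation; this gives the isolated `ball q n j`. The second part loses
  -- its index 0.
  cap-suc : ∀ n j → cap (suc n) (ball q (suc n) j) ≡
            q * (cap n (ball q n j) + ball q n j) + cap n (previous (ball q n) j)
  cap-suc n j = begin
    cap (suc n) (ball q (suc n) j)
      ≡⟨ ∑-cong (suc n) (ball-⊓ n j ∘ toℕ) ⟩
    ∑ (suc n) (λ i → q * (bⱼ ⊓ ball q n (toℕ i)) + pⱼ ⊓ previous (ball q n) (toℕ i))
      ≡⟨ ∑-shift n (λ i → q * (bⱼ ⊓ ball q n i)) (λ i → pⱼ ⊓ previous (ball q n) i) (⊓-zeroʳ pⱼ) ⟩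
    (∑ n (λ i → q * (bⱼ ⊓ ball q n (toℕ i))) + q * (bⱼ ⊓ ball q n n)) + cap n pⱼ
      ≡⟨ cong (λ z → (z + q * (bⱼ ⊓ ball q n n)) + cap n pⱼ)
              (∑-* n q (λ i → bⱼ ⊓ ball q n (toℕ i))) ⟨
    (q * cap n bⱼ + q * (bⱼ ⊓ ball q n n)) + cap n pⱼ
      ≡⟨ cong (_+ cap n pⱼ) (*-distribˡ-+ q (cap n bⱼ) (bⱼ ⊓ ball q n n)) ⟨
    q * (cap n bⱼ + bⱼ ⊓ ball q n n) + cap n pⱼ
      ≡⟨ cong (λ z → q * (cap n bⱼ + z) + cap n pⱼ) (m≤n⇒m⊓n≡m (ball≤ball-n q n j)) ⟩
    q * (cap n bⱼ + bⱼ) + cap n pⱼ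
      ∎
    where
    open ≡-Reasoning
    bⱼ = ball q n j
    pⱼ = previous (ball q n) j

  -- Induction on `n` through `cap-suc`: both `cap` terms there are again taken at ball sizes, or at
  -- 0, and the recursion of `ball` reassembles the result. This equality is what makes the main
  -- inequality sharp for `ℬ`.
  cap-ball : ∀ n j → cap (suc n) (ball q (suc n) j) ≡ suc n * q * ball q n j
  cap-ball zero    j = trans (cap-suc zero j) (arith q)
    where
    arith : ∀ q → q * 1 + 0 ≡ (q + 0) * 1
    arith = solve-∀
  cap-ball (suc n) j = begin
    cap (2+ n) (ball q (2+ n) j)
      ≡⟨ cap-suc (suc n) j ⟩
    q * (cap (suc n) (ball q (suc n) j) + ball q (suc n) j) +
    cap (suc n) (previous (ball q (suc n)) j)
      ≡⟨ cong₂ (λ y z → q * (y + ball q (suc n) j) + z) (cap-ball n j) (cap-previous j) ⟩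
    q * (suc n * q * ball q n j + ball q (suc n) j) + suc n * q * previous (ball q n) j
      ≡⟨ arith n q (ball q n j) (previous (ball q n) j) ⟩
    (2+ n) * q * ball q (suc n) j
      ∎
    where
    open ≡-Reasoning
    arith : ∀ n q b p → q * (suc n * q * b + (q * b + p)) + suc n * q * p ≡
                        (2+ n) * q * (q * b + p)
    arith = solve-∀
    cap-previous : ∀ j → cap (suc n) (previous (ball q (suc n)) j) ≡
                   suc n * q * previous (ball q n) j
    cap-previous zero    = trans (cap-zero (suc n)) (sym (*-zeroʳ (suc n * q)))
    cap-previous (suc j) = cap-ball n j

  -- The complement of `cap-ball` within `cap+excess`. The factor `q` gives the right side the same
  -- coefficient `suc n * q` as in `cap-ball`.
  excess-ball : ∀ n j → q * excess (suc n) (ball q (suc n) j) ≡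
                suc n * q * previous (ball q n) j
  excess-ball n j = +-cancelˡ-≡ (q * (suc n * q * bⱼ)) _ _ (begin
    q * (suc n * q * bⱼ) + q * e             ≡⟨ cong (λ z → q * z + q * e) (cap-ball n j) ⟨
    q * cap (suc n) b′ + q * e               ≡⟨ *-distribˡ-+ q (cap (suc n) b′) e ⟨
    q * (cap (suc n) b′ + e)                 ≡⟨ cong (q *_) (cap+excess (suc n) b′) ⟩
    q * (suc n * b′)                         ≡⟨ arith n q bⱼ pⱼ ⟩
    q * (suc n * q * bⱼ) + suc n * q * pⱼ    ∎)
    where
    open ≡-Reasoning
    bⱼ = ball q n j
    pⱼ = previous (ball q n) j
    b′ = ball q (suc n) j
    e  = excess (suc n) b′
    arith : ∀ n q b p → q * (suc n * (q * b + p)) ≡ q * (suc n * q * b) + suc n * q * p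
    arith = solve-∀

  -- By cap-ball and excess-ball all three minima switch at m = ball q (suc n) j.
  aligned : ∀ n m j → suc n * q * (m ⊓ ball q (suc n) j) ≤
            q * (cap (suc n) m ⊓ (suc n * q * ball q n j)) +
            (q * excess (suc n) m) ⊓ (suc n * q * previous (ball q n) j)
  aligned n m j with ≤-total m (ball q (suc n) j)
  ... | inj₁ m≤b = ≤-reflexive (begin
    D * (m ⊓ b′)                                    ≡⟨ cong (D *_) (m≤n⇒m⊓n≡m m≤b) ⟩
    D * m                                           ≡⟨ arith n q m ⟩
    q * (suc n * m)                                 ≡⟨ cong (q *_) (cap+excess (suc n) m) ⟨
    q * (cap (suc n) m + excess (suc n) m)          ≡⟨ *-distribˡ-+ q (cap (suc n) m) _ ⟩
    q * cap (suc n) m + q * excess (suc n) m        ≡⟨ cong₂ (λ y z → q * y + z) (m≤n⇒m⊓n≡m cap≤) (m≤n⇒m⊓n≡m excess≤) ⟨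
    q * (cap (suc n) m ⊓ (D * bⱼ)) + (q * excess (suc n) m) ⊓ (D * pⱼ) ∎)
    where
    open ≡-Reasoning
    D = suc n * q
    bⱼ = ball q n j
    pⱼ = previous (ball q n) j
    b′ = ball q (suc n) j
    arith : ∀ n q m → suc n * q * m ≡ q * (suc n * m)
    arith = solve-∀
    cap≤ : cap (suc n) m ≤ D * bⱼ
    cap≤ = ≤-trans (cap-mono (suc n) m≤b) (≤-reflexive (cap-ball n j))
    excess≤ : q * excess (suc n) m ≤ D * pⱼ
    excess≤ = ≤-trans (*-monoʳ-≤ q (excess-mono (suc n) m≤b)) (≤-reflexive (excess-ball n j))
  ... | inj₂ b≤m = ≤-reflexive (begin
    D * (m ⊓ b′)                                    ≡⟨ cong (D *_) (m≥n⇒m⊓n≡n b≤m) ⟩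
    D * (q * bⱼ + pⱼ)                               ≡⟨ arith D q bⱼ pⱼ ⟩
    q * (D * bⱼ) + D * pⱼ                           ≡⟨ cong₂ (λ y z → q * y + z) (m≥n⇒m⊓n≡n ≤cap) (m≥n⇒m⊓n≡n ≤excess) ⟨
    q * (cap (suc n) m ⊓ (D * bⱼ)) + (q * excess (suc n) m) ⊓ (D * pⱼ) ∎)
    where
    open ≡-Reasoning
    D = suc n * q
    bⱼ = ball q n j
    pⱼ = previous (ball q n) j
    b′ = ball q (suc n) j
    arith : ∀ D q b p → D * (q * b + p) ≡ q * (D * b) + D * p
    arith = solve-∀
    ≤cap : D * bⱼ ≤ cap (suc n) m
    ≤cap = ≤-trans (≤-reflexive (sym (cap-ball n j))) (cap-mono (suc n) b≤m)
    ≤excess : D * pⱼ ≤ q * excess (suc n) m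
    ≤excess = ≤-trans (≤-reflexive (sym (excess-ball n j))) (*-monoʳ-≤ q (excess-mono (suc n) b≤m))

  -- If the claim failed, every D * x a would be below S = cap (suc n) (∑ x), so
  -- ∑-⊓-lower applies with T = S; the factor D keeps this threshold integral.
  merge : ∀ {r} n .{{_ : NonZero n}} .{{_ : NonZero q}} (x d : Fin r → ℕ) y →
          (∀ a → x a ≤ y) → ∑ r d ≤ y → (∀ a → cap n (x a) ≤ n * q * d a) →
          cap (suc n) (∑ r x) ≤ suc n * q * y
  merge {r} n x d y x≤y d≤y ih with ≤-total (suc n * q * y) (cap (suc n) (∑ r x))
  ... | inj₂ S≤Dy = S≤Dy
  ... | inj₁ Dy≤S = *-cancelˡ-≤ (n * q) {{m*n≢0 n q}} (+-cancelʳ-≤ (q * S) _ _ (begin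
    n * q * S + q * S
      ≡⟨ arith₁ n q S ⟩
    D * S
      ≡⟨ ∑-* (suc n) D (λ j → m ⊓ ball q (suc n) (toℕ j)) ⟩
    ∑ (suc n) (λ j → D * (m ⊓ ball q (suc n) (toℕ j)))
      ≤⟨ ∑-mono (suc n) (aligned n m ∘ toℕ) ⟩
    ∑ (suc n) (λ j → q * (S ⊓ (D * b (toℕ j))) + R ⊓ (D * previous b (toℕ j)))
      -- After the shift, `S` and `R` are truncated at the same level `D * b j` for each j < n.
      ≡⟨ ∑-shift n f h (trans (cong (R ⊓_) (*-zeroʳ D)) (⊓-zeroʳ R)) ⟩
    (∑ n (f ∘ toℕ) + f n) + ∑ n (h ∘ suc ∘ toℕ)
      -- The leftover term j = n costs at most `q * S`, which is exactly the difference between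
      -- `D * S` and `n * q * S`.
      ≤⟨ +-monoˡ-≤ (∑ n (h ∘ suc ∘ toℕ)) (+-monoʳ-≤ (∑ n (f ∘ toℕ)) (*-monoʳ-≤ q (m⊓n≤m S (D * b n)))) ⟩
    (∑ n (f ∘ toℕ) + q * S) + ∑ n (h ∘ suc ∘ toℕ)
      ≡⟨ arith₂ (∑ n (f ∘ toℕ)) (q * S) (∑ n (h ∘ suc ∘ toℕ)) ⟩
    (∑ n (f ∘ toℕ) + ∑ n (h ∘ suc ∘ toℕ)) + q * S
      ≡⟨ cong (_+ q * S) (∑-+ n (f ∘ toℕ) (h ∘ suc ∘ toℕ)) ⟨
    ∑ n (λ j → q * (S ⊓ (D * b (toℕ j))) + R ⊓ (D * b (toℕ j))) + q * S
      -- For each j separately, the numbers `D * x a` are at most `S` and add up to `q * S + R`.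
      ≤⟨ +-monoˡ-≤ (q * S) (∑-mono n λ j → ∑-⊓-lower (λ a → D * x a) S (D * b (toℕ j)) q R Dx≤S total) ⟩
    ∑ n (λ j → ∑ r (λ a → (D * x a) ⊓ (D * b (toℕ j)))) + q * S
      ≡⟨ cong (_+ q * S) (∑-comm +-*-semiring {n} {r} λ j a → (D * x a) ⊓ (D * b (toℕ j))) ⟩
    ∑ r (λ a → ∑ n (λ j → (D * x a) ⊓ (D * b (toℕ j)))) + q * S
      ≤⟨ +-monoˡ-≤ (q * S) (∑-mono r scaled-ih) ⟩
    ∑ r (λ a → D * (n * q) * d a) + q * S
      ≡⟨ cong (_+ q * S) (∑-* r (D * (n * q)) d) ⟨
    D * (n * q) * ∑ r d + q * S
      ≤⟨ +-monoˡ-≤ (q * S) (*-monoʳ-≤ (D * (n * q)) d≤y) ⟩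
    D * (n * q) * y + q * S
      ≡⟨ cong (_+ q * S) (arith₃ D (n * q) y) ⟩
    n * q * (D * y) + q * S
      ∎))
    where
    open ≤-Reasoning
    b = ball q n
    m = ∑ r x
    D = suc n * q
    S = cap (suc n) m
    R = q * excess (suc n) m
    f h : ℕ → ℕ
    f j = q * (S ⊓ (D * b j))
    h j = R ⊓ (D * previous b j)
    arith₁ : ∀ n q s → n * q * s + q * s ≡ suc n * q * s
    arith₁ = solve-∀
    arith₂ : ∀ a b c → (a + b) + c ≡ (a + c) + b
    arith₂ = solve-∀
    arith₃ : ∀ a b c → a * b * c ≡ b * (a * c)
    arith₃ = solve-∀
    arith₄ : ∀ n q m → q * (suc n * m) ≡ suc n * q * m
    arith₄ = solve-∀
    Dx≤S : ∀ a → D * x a ≤ S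
    Dx≤S a = ≤-trans (*-monoʳ-≤ D (x≤y a)) Dy≤S
    total : q * S + R ≤ ∑ r (λ a → D * x a)
    total = begin
      q * S + R                           ≡⟨ *-distribˡ-+ q S (excess (suc n) m) ⟨
      q * (S + excess (suc n) m)          ≡⟨ cong (q *_) (cap+excess (suc n) m) ⟩
      q * (suc n * m)                     ≡⟨ arith₄ n q m ⟩
      D * m                               ≡⟨ ∑-* r D x ⟩
      ∑ r (λ a → D * x a)                 ∎
    scaled-ih : ∀ a → ∑ n (λ j → (D * x a) ⊓ (D * b (toℕ j))) ≤ D * (n * q) * d a
    scaled-ih a = begin
      ∑ n (λ j → (D * x a) ⊓ (D * b (toℕ j)))  ≡⟨ ∑-cong n (λ j → *-distribˡ-⊓ D (x a) (b (toℕ j))) ⟨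
      ∑ n (λ j → D * (x a ⊓ b (toℕ j)))        ≡⟨ ∑-* n D (λ j → x a ⊓ b (toℕ j)) ⟨
      D * cap n (x a)                          ≤⟨ *-monoʳ-≤ D (ih a) ⟩
      D * (n * q * d a)                        ≡⟨ *-assoc D (n * q) (d a) ⟨
      D * (n * q) * d a                        ∎

-- Cardinalities of families, counted by first letter.

∣∣-mono : ∀ {r n} {F G : Family r n} (F? : Decidable F) (G? : Decidable G) →
          F ⊆ G → ∣ F? ∣ ≤ ∣ G? ∣
∣∣-mono {r} {n} F? G? F⊆G =
  length-mono-≤ (filter⁺ F? G? (λ { refl → F⊆G }) (⊆-refl {x = words r n}))

∣∣-cong : ∀ {r n} {F G : Family r n} (F? : Decidable F) (G? : Decidable G) →
          F ⊆ G → G ⊆ F → ∣ F? ∣ ≡ ∣ G? ∣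
∣∣-cong F? G? F⊆G G⊆F = ≤-antisym (∣∣-mono F? G? F⊆G) (∣∣-mono G? F? G⊆F)

∣∣-empty : ∀ {r n} {F : Family r n} (F? : Decidable F) → (∀ w → ¬ F w) → ∣ F? ∣ ≡ 0
∣∣-empty {r} {n} F? ¬F = cong length (filter-none F? (ListAll.universal ¬F (words r n)))

∣∣≡0⇒empty : ∀ {r n} {F : Family r n} (F? : Decidable F) → ∣ F? ∣ ≡ 0 → ∀ w → ¬ F w
∣∣≡0⇒empty F? ∣F∣≡0 w Fw = <⇒≢ (filter-some F? (lose (words-complete w) Fw)) (sym ∣F∣≡0)

∣∣-suc : ∀ {r n} {F : Family r (suc n)} (F? : Decidable F) →
         ∣ F? ∣ ≡ ∑ r (λ a → ∣ F? ∘ (a ∷_) ∣)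
∣∣-suc {r} {n} {F} F? = length-filter-product r (λ a → a)
  where
  length-filter-map : ∀ a (ws : List (Word r n)) →
    length (filter F? (List.map (a ∷_) ws)) ≡ length (filter (F? ∘ (a ∷_)) ws)
  length-filter-map a []       = refl
  length-filter-map a (w ∷ ws) with does (F? (a ∷ w))
  ... | true  = cong suc (length-filter-map a ws)
  ... | false = length-filter-map a ws

  -- The alphabet is generalised to an arbitrary tabulation, because the induction passes to its
  -- tail.
  length-filter-product : ∀ l (f : Fin l → Fin r) →
    length (filter F? (cartesianProductWith _∷_ (List.tabulate f) (words r n))) ≡
    ∑ l (λ i → ∣ F? ∘ (f i ∷_) ∣)
  length-filter-product zero    f = refl
  length-filter-product (suc l) f = begin
    length (filter F? (here ++ there))                   ≡⟨ cong length (filter-++ F? here there) ⟩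
    length (filter F? here ++ filter F? there)           ≡⟨ length-++ (filter F? here) ⟩
    length (filter F? here) + length (filter F? there)   ≡⟨ cong₂ _+_ (length-filter-map (f zero) (words r n))
                                                                     (length-filter-product l (f ∘ suc)) ⟩
    ∑ (suc l) (λ i → ∣ F? ∘ (f i ∷_) ∣)                  ∎
    where
    open ≡-Reasoning
    here  = List.map (f zero ∷_) (words r n)
    there = cartesianProductWith _∷_ (List.tabulate (f ∘ suc)) (words r n)

-- Shadows and first-letter sections.

∣section∣≤∣Δ∣ : ∀ {r n} {F : Family r (suc n)} (F? : Decidable F) a →
              ∣ F? ∘ (a ∷_) ∣ ≤ ∣ Δ? F? ∣
∣section∣≤∣Δ∣ F? a = ∣∣-mono (F? ∘ (a ∷_)) (Δ? F?) λ {w} Faw → zero , a ∷ w , Faw , refl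

Δ-section : ∀ {r n} {F : Family r (2+ n)} a → Δ (F ∘ (a ∷_)) ⊆ Δ F ∘ (a ∷_)
Δ-section a (i , x@(_ ∷ _) , Fax , refl) = suc i , a ∷ x , Fax , refl

-- Deletions behind the first letter keep that letter, so distinct letters contribute disjoint parts
-- of the shadow.
∑∣Δ-section∣≤∣Δ∣ : ∀ {r n} {F : Family r (2+ n)} (F? : Decidable F) →
                 ∑ r (λ a → ∣ Δ? (F? ∘ (a ∷_)) ∣) ≤ ∣ Δ? F? ∣
∑∣Δ-section∣≤∣Δ∣ {r} {n} {F} F? = ≤-trans
  (∑-mono r λ a → ∣∣-mono (Δ? (F? ∘ (a ∷_))) (Δ? F? ∘ (a ∷_)) (Δ-section {F = F} a))
  (≤-reflexive (sym (∣∣-suc (Δ? F?))))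

-- A crude bound, serving to show that a family with empty shadow is empty.
∣F∣≤r*∣ΔF∣ : ∀ {r n} {F : Family r (suc n)} (F? : Decidable F) → ∣ F? ∣ ≤ r * ∣ Δ? F? ∣
∣F∣≤r*∣ΔF∣ {r} F? = begin
  ∣ F? ∣                          ≡⟨ ∣∣-suc F? ⟩
  ∑ r (λ a → ∣ F? ∘ (a ∷_) ∣)     ≤⟨ ∑-mono r (∣section∣≤∣Δ∣ F?) ⟩
  ∑ r (λ _ → ∣ Δ? F? ∣)           ≡⟨ ∑-const r ∣ Δ? F? ∣ ⟩
  r * ∣ Δ? F? ∣                   ∎
  where open ≤-Reasoning

∣ΔF∣≡0⇒∣F∣≡0 : ∀ {r n} {F : Family r (suc n)} (F? : Decidable F) → ∣ Δ? F? ∣ ≡ 0 → ∣ F? ∣ ≡ 0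
∣ΔF∣≡0⇒∣F∣≡0 {r} F? ∣ΔF∣≡0 = n≤0⇒n≡0 (≤-trans (∣F∣≤r*∣ΔF∣ F?)
  (≤-reflexive (trans (cong (r *_) ∣ΔF∣≡0) (*-zeroʳ r))))

-- The main inequality and its value at ball sizes.

cap≤∣Δ∣ : ∀ q .{{_ : NonZero q}} {r} n {F : Family r (suc n)} (F? : Decidable F) →
          cap q (suc n) ∣ F? ∣ ≤ suc n * q * ∣ Δ? F? ∣
-- For words of length one, `cap` is at most `q`, so a nonempty shadow suffices; an empty one forces
-- F to be empty.
cap≤∣Δ∣ q zero F? with ∣ Δ? F? ∣ in eq
... | zero  rewrite ∣ΔF∣≡0⇒∣F∣≡0 F? eq = z≤n
... | suc y = begin
  ∣ F? ∣ ⊓ (q * 1 + 0) + 0   ≡⟨ +-identityʳ _ ⟩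
  ∣ F? ∣ ⊓ (q * 1 + 0)       ≤⟨ m⊓n≤n ∣ F? ∣ (q * 1 + 0) ⟩
  q * 1 + 0                  ≤⟨ m≤m+n _ (q * y) ⟩
  q * 1 + 0 + q * y          ≡⟨ arith q y ⟩
  1 * q * suc y              ∎
  where
  open ≤-Reasoning
  arith : ∀ q y → q * 1 + 0 + q * y ≡ 1 * q * suc y
  arith = solve-∀
cap≤∣Δ∣ q {r} (suc n) F? = subst (λ m → cap q (2+ n) m ≤ (2+ n) * q * ∣ Δ? F? ∣) (sym (∣∣-suc F?))
  (merge q (suc n) (λ a → ∣ F? ∘ (a ∷_) ∣) (λ a → ∣ Δ? (F? ∘ (a ∷_)) ∣) ∣ Δ? F? ∣
    (∣section∣≤∣Δ∣ F?) (∑∣Δ-section∣≤∣Δ∣ F?) (λ a → cap≤∣Δ∣ q n (F? ∘ (a ∷_))))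

ball≤∣Δ∣ : ∀ q .{{_ : NonZero q}} {r} n k {F : Family r (suc n)} (F? : Decidable F) →
           ∣ F? ∣ ≡ ball q (suc n) k → ball q n k ≤ ∣ Δ? F? ∣
ball≤∣Δ∣ q n k F? ∣F∣≡ball = *-cancelˡ-≤ (suc n * q) {{m*n≢0 (suc n) q}} (begin
  suc n * q * ball q n k               ≡⟨ cap-ball q n k ⟨
  cap q (suc n) (ball q (suc n) k)     ≡⟨ cong (cap q (suc n)) ∣F∣≡ball ⟨
  cap q (suc n) ∣ F? ∣                 ≤⟨ cap≤∣Δ∣ q n F? ⟩
  suc n * q * ∣ Δ? F? ∣                ∎)
  where open ≤-Reasoning

-- The cardinality of `ℬ`.

∑-threshold : ∀ {r} (s : Fin r) (f : Fin r → ℕ) {x y} → (∀ a → a Fin.< s → f a ≡ x) →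
              f s ≡ y → (∀ a → s Fin.< a → f a ≡ 0) → ∑ r f ≡ toℕ s * x + y
∑-threshold {suc r} zero f {x} {y} below at above = begin
  f zero + ∑ r (f ∘ suc)   ≡⟨ cong₂ _+_ at (∑-cong r λ a → above (suc a) (s≤s z≤n)) ⟩
  y + ∑ r (λ _ → 0)        ≡⟨ cong (y +_) (trans (∑-const r 0) (*-zeroʳ r)) ⟩
  y + 0                    ≡⟨ +-identityʳ y ⟩
  y                        ∎
  where open ≡-Reasoning
∑-threshold {suc r} (suc s) f {x} {y} below at above = trans
  (cong₂ _+_ (below zero (s≤s z≤n))
    (∑-threshold s (f ∘ suc) (λ a → below (suc a) ∘ s≤s) at (λ a → above (suc a) ∘ s≤s)))
  (sym (+-assoc x (toℕ s * x) y))

count-≡ : ∀ {r n} (s : Fin r) (w : Word r n) →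
          count (Fin._≟ s) (s ∷ w) ≡ suc (count (Fin._≟ s) w)
count-≡ s w rewrite dec-true (s Fin.≟ s) refl = refl

count-≢ : ∀ {r n} {a s : Fin r} → a ≢ s → (w : Word r n) →
          count (Fin._≟ s) (a ∷ w) ≡ count (Fin._≟ s) w
count-≢ {a = a} {s} a≢s w rewrite dec-false (a Fin.≟ s) a≢s = refl

-- Each of the `toℕ s` first letters below s leaves the bound k unchanged, the letter s lowers it by
-- one, and larger letters are excluded. This is the recursion of `ball`.
∣ℬ∣≡ball : ∀ {r} n (s : Fin r) k → ∣ ℬ? {r} {n} s k ∣ ≡ ball (toℕ s) n k
∣ℬ∣≡ball zero    s k = refl
∣ℬ∣≡ball {r} (suc n) s k = trans (∣∣-suc (ℬ? {r} {suc n} s k))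
  (∑-threshold s (λ a → ∣ ℬₐ? a k ∣) below (at k) above)
  where
  ℬₐ? : ∀ a k → Decidable (λ (w : Word r n) → ℬ s k (a ∷ w))
  ℬₐ? a k w = ℬ? s k (a ∷ w)

  below : ∀ a → a Fin.< s → ∣ ℬₐ? a k ∣ ≡ ball (toℕ s) n k
  below a a<s = trans (∣∣-cong (ℬₐ? a k) (ℬ? {r} {n} s k)
    (λ { {w} (_ ∷ w≤s , c≤k) → w≤s , subst (_≤ k) (count-≢ a≢s w) c≤k })
    (λ { {w} (w≤s , c≤k) → <⇒≤ a<s ∷ w≤s , subst (_≤ k) (sym (count-≢ a≢s w)) c≤k }))
    (∣ℬ∣≡ball n s k)
    where
    a≢s : a ≢ s
    a≢s refl = <-irrefl refl a<s

  at : ∀ k → ∣ ℬₐ? s k ∣ ≡ previous (ball (toℕ s) n) k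
  at zero    = ∣∣-empty (ℬₐ? s 0) λ where
    w (_ , c≤0) → contradiction (subst (_≤ 0) (count-≡ s w) c≤0) λ ()
  at (suc k) = trans (∣∣-cong (ℬₐ? s (suc k)) (ℬ? {r} {n} s k)
    (λ { {w} (_ ∷ w≤s , c≤k) → w≤s , ≤-pred (subst (_≤ suc k) (count-≡ s w) c≤k) })
    (λ { {w} (w≤s , c≤k) → ≤-refl ∷ w≤s , subst (_≤ suc k) (sym (count-≡ s w)) (s≤s c≤k) }))
    (∣ℬ∣≡ball n s k)

  above : ∀ a → s Fin.< a → ∣ ℬₐ? a k ∣ ≡ 0
  above a s<a = ∣∣-empty (ℬₐ? a k) λ where
    w (a≤s ∷ _ , _) → <⇒≱ s<a a≤s

-- The shadow of `ℬ`, and the comparison.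

All-removeAt : ∀ {r n p} {P : Pred (Fin r) p} {w : Word r (suc n)} (i : Fin (suc n)) →
               All P w → All P (removeAt w i)
All-removeAt zero    (_ ∷ ps)         = ps
All-removeAt (suc i) (p ∷ ps@(_ ∷ _)) = p ∷ All-removeAt i ps

count-removeAt : ∀ {r n} (s : Fin r) (w : Word r (suc n)) i →
                 count (Fin._≟ s) (removeAt w i) ≤ count (Fin._≟ s) w
count-removeAt s (a ∷ w) zero with does (a Fin.≟ s)
... | true  = n≤1+n _
... | false = ≤-refl
count-removeAt s (a ∷ w@(_ ∷ _)) (suc i) with does (a Fin.≟ s)
... | true  = s≤s (count-removeAt s w i)
... | false = count-removeAt s w i

Δℬ⊆ℬ : ∀ {r n} (s : Fin r) k → Δ (ℬ {r} {suc n} s k) ⊆ ℬ s k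
Δℬ⊆ℬ s k (i , w , (w≤s , c≤k) , refl) = All-removeAt i w≤s , ≤-trans (count-removeAt s w i) c≤k

∣Δℬ∣≤ball : ∀ {r} n (s : Fin r) k → ∣ Δ? (ℬ? {r} {suc n} s k) ∣ ≤ ball (toℕ s) n k
∣Δℬ∣≤ball {r} n s k = ≤-trans (∣∣-mono (Δ? (ℬ? {r} {suc n} s k)) (ℬ? s k) (Δℬ⊆ℬ s k))
  (≤-reflexive (∣ℬ∣≡ball n s k))

-- With q = 0 the alphabet [s] has a single letter, hence at most one word of each length.
ball-0≤1 : ∀ n k → ball 0 n k ≤ 1
ball-0≤1 zero    k       = ≤-refl
ball-0≤1 (suc n) zero    = z≤n
ball-0≤1 (suc n) (suc k) = ball-0≤1 n k

theorem2 : ∀ (r n : ℕ) (s : Fin r) (k : ℕ) → k ≤ suc n →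
    (F : Family r (suc n)) (F? : Decidable F) →
    ∣ F? ∣ ≡ ∣ ℬ? {r} {suc n} s k ∣ →
    ∣ Δ? (ℬ? {r} {suc n} s k) ∣ ≤ ∣ Δ? F? ∣
theorem2 r n s k _ F F? ∣F∣≡∣ℬ∣ with toℕ s ≟ 0
... | no s≢0 = ≤-trans (∣Δℬ∣≤ball n s k)
  (ball≤∣Δ∣ (toℕ s) {{≢-nonZero s≢0}} n k F? (trans ∣F∣≡∣ℬ∣ (∣ℬ∣≡ball (suc n) s k)))
-- For q = 0 there is no factor to cancel. The shadow of `ℬ` then has at most one word, so a
-- nonempty ΔF is enough; if ΔF is empty, then so are F, `ℬ` and the shadow of `ℬ`.
... | yes s≡0 with ∣ Δ? F? ∣ in ∣ΔF∣
...   | suc y = ≤-trans (∣Δℬ∣≤ball n s k)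
  (≤-trans (subst (λ q → ball q n k ≤ 1) (sym s≡0) (ball-0≤1 n k)) (s≤s z≤n))
...   | zero  = ≤-reflexive (∣∣-empty (Δ? (ℬ? {r} {suc n} s k)) λ where
  _ (_ , w , ℬw , _) →
    ∣∣≡0⇒empty (ℬ? s k) (trans (sym ∣F∣≡∣ℬ∣) (∣ΔF∣≡0⇒∣F∣≡0 F? ∣ΔF∣)) w ℬw)
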